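{- Let $p$ be an odd prime. Suppose that either $p = 40k_3 + 11$ for some integer $k_3$ such that $160k_3+49$ is a perfect square, or $p = 40k_4+19$ for some integer $k_4$ such that $160k_4+81$ is a perfect square. Then the elliptic curve $E_p : y^2 = x^3 - 5px$ has rank at least one over $\mathbb{Q}$.
   Context: The rank of an elliptic curve $E$ over a field $K$ is the rank $r$ of the finitely generated abelian group $E(K) \cong \mathbb{Z}^r \oplus E(K)_{\mathrm{tors}}$. -}

module Defs where

open import Data.Nat using (ℕ; zero; suc; _≥_)
open import Data.Integer as ℤ using (ℤ)
open import Data.Rational as ℚ using (ℚ; 0ℚ; _+_; _-_; _*_; _÷_; ≢-nonZero)
open import Data.Rational.Properties using (_≟_)
open import Data.Unit using (⊤)
open import Data.Product using (Σ; _×_; ∃)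
open import Relation.Binary.PropositionalEquality using (_≡_; _≢_)
open import Relation.Nullary using (yes; no)

data Point : Set where
  O   : Point
  aff : ℚ → ℚ → Point

OnCurve : ℚ → ℚ → Point → Set
OnCurve a b O         = ⊤
OnCurve a b (aff x y) = y * y ≡ x * x * x + a * x + b

-- x₂ - x₁ ≡ 0 is the case x₁ = x₂.
-- The chord-and-tangent group law (standard formulas).
-- In the tangent case (x1 = x2, y1 + y2 ≠ 0) the denominator is written
-- y1 + y2, which equals 2 y1 for points on the curve (there y1 = ± y2).
addPt : ℚ → Point → Point → Point
addPt a O Q = Q
addPt a P O = P
addPt a (aff x₁ y₁) (aff x₂ y₂) with x₂ - x₁ ≟ 0ℚ
... | no d≢0 =
      let instance _ = ≢-nonZero {x₂ - x₁} d≢0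
          λ′ = (y₂ - y₁) ÷ (x₂ - x₁)
          x₃ = λ′ * λ′ - x₁ - x₂
      in aff x₃ (λ′ * (x₁ - x₃) - y₁)
... | yes _ with y₁ + y₂ ≟ 0ℚ
...   | yes _ = O
...   | no s≢0 =
      let instance _ = ≢-nonZero {y₁ + y₂} s≢0
          λ′ = ((ℤ.+ 3 ℚ./ 1) * x₁ * x₁ + a) ÷ (y₁ + y₂)
          x₃ = λ′ * λ′ - x₁ - x₂
      in aff x₃ (λ′ * (x₁ - x₃) - y₁)

mulPt : ℚ → ℕ → Point → Point
mulPt a zero    P = O
mulPt a (suc n) P = addPt a P (mulPt a n P)

-- E_{a,b}(ℚ) has rank at least one: E(ℚ) ≅ ℤ^r ⊕ torsion with r ≥ 1,
-- i.e. E(ℚ) contains a point of infinite order.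
RankAtLeastOne : ℚ → ℚ → Set
RankAtLeastOne a b =
  Σ Point λ P → OnCurve a b P × (∀ n → n ≥ 1 → mulPt a n P ≢ O)

IsPerfectSquare : ℤ → Set
IsPerfectSquare m = ∃ λ (s : ℤ) → m ≡ s ℤ.* s

{-# OPTIONS --safe #-}

-- In both cases the square s² satisfies s² = 4p + 5, and (s²/4, s(s² - 10)/8) is a point P of E_p.
-- Work 2-adically: 4 x(P) = s² is an odd unit, and the addition formulas show that odd multiples
-- of P keep this property, while even multiples are O or satisfy 1/x ∈ 8 ℤ₍₂₎. In particular no odd
-- multiple is O and no multiple has y = 0. If n P = O then n = 2m, and (n - j) P = -(j P) for all j;
-- for j = m this gives m P = -(m P), hence m P = O because its ordinate cannot vanish, and descent
-- on n ends the proof. The reflection only needs the cancellation -P + (P + Q) = Q, so the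
-- associativity of the group law is never used.
module Submission where

open import Defs

module RationalPoints where
  open import Data.Empty using (⊥; ⊥-elim)
  open import Data.Integer as ℤ using (ℤ; +_; -[1+_]; +[1+_]; ∣_∣)
  import Data.Integer.GCD as ℤ
  import Data.Integer.Properties as ℤ
  import Data.Integer.Solver as ℤ
  open import Data.Nat as ℕ using (ℕ; zero; suc; z≤n; s≤s)
  open import Data.Nat.Coprimality using (Coprime)
  open import Data.Nat.Divisibility using (_∣_; _∣?_; divides; ∣-trans; m∣m*n; ∣1⇒≡1)
  open import Data.Nat.Induction using (<-rec)
  open import Data.Nat.Primality using (prime[2]; euclidsLemma)
  import Data.Nat.Properties as ℕ
  open import Data.Product using (∃; _×_; _,_; proj₁; proj₂)
  open import Data.Rational
    using (ℚ; mkℚ; 0ℚ; 1ℚ; ½; _+_; _-_; _*_; -_; _÷_; 1/_; _/_; ↥_; ↧_; ↧ₙ_; toℚᵘ; NonZero; ≢-nonZero)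
  open import Data.Rational.Properties
  open import Algebra.Properties.Group +-0-group using () renaming
    (⁻¹-involutive to neg-involutive; x∙y⁻¹≈ε⇒x≈y to p-q≡0⇒p≡q; x≈y⇒x∙y⁻¹≈ε to p≡q⇒p-q≡0)
  open import Data.Rational.Solver using (module +-*-Solver)
  open import Data.Rational.Unnormalised as ℚᵘ using (mkℚᵘ; *≡*)
  import Data.Rational.Unnormalised.Properties as ℚᵘ
  open import Data.Sum using (_⊎_; inj₁; inj₂; [_,_]′)
  open import Data.Unit using (⊤; tt)
  open import Relation.Binary.PropositionalEquality
  open import Relation.Nullary using (¬_; yes; no; contradiction)
  open import Relation.Nullary.Negation.Core using (contradiction-irr)
  open +-*-Solver

  -- Integers as rationals.

  2∤1 : ¬ 2 ∣ 1
  2∤1 2∣1 = contradiction (∣1⇒≡1 2∣1) λ ()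

  -- Unlike `i / 1`, which is normalised through a gcd and is stuck for a variable `i`, this form
  -- lets sums and products unfold; the homomorphism laws below rest on that.
  cast : ℤ → ℚ
  cast i = mkℚ i 0 λ (_ , d∣1) → ∣1⇒≡1 d∣1

  cast≡/1 : ∀ i → cast i ≡ i / 1
  cast≡/1 i = sym (↥p/↧p≡p (cast i))

  /1-homo-+ : ∀ i j → (i ℤ.+ j) / 1 ≡ i / 1 + j / 1
  /1-homo-+ i j = begin
    (i ℤ.+ j) / 1                    ≡⟨ cong₂ (λ k l → (k ℤ.+ l) / 1) (ℤ.*-identityʳ i) (ℤ.*-identityʳ j) ⟨
    cast i + cast j                  ≡⟨ cong₂ _+_ (cast≡/1 i) (cast≡/1 j) ⟩
    i / 1 + j / 1                    ∎
    where open ≡-Reasoning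

  /1-homo-* : ∀ i j → (i ℤ.* j) / 1 ≡ i / 1 * (j / 1)
  /1-homo-* i j = cong₂ _*_ (cast≡/1 i) (cast≡/1 j)

  /1-homo-neg : ∀ i → (ℤ.- i) / 1 ≡ - (i / 1)
  /1-homo-neg (+ zero)  = refl
  /1-homo-neg (+ suc n) = refl
  /1-homo-neg -[1+ n ]  = sym (neg-involutive _)

  -- The localisation of ℤ at 2.

  -- Membership in the localisation ℤ₍₂₎ of ℤ at 2.
  record Integral (r : ℚ) : Set where
    constructor integral
    field odd-denominator : ¬ 2 ∣ ↧ₙ r

  -- The reduced denominator of a sum or product divides the product of the denominators, with the
  -- cancelled gcd as cofactor `n`. If 2 divided it, Euclid's lemma would make 2 divide one of the
  -- factors.
  integral-∣ : ∀ p q r {n} → ↧ r ℤ.* n ≡ ↧ p ℤ.* ↧ q → Integral p → Integral q → Integral r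
  integral-∣ p q r {n} eq (integral ip) (integral iq) = integral λ 2∣r →
    [ ip , iq ]′ (euclidsLemma (↧ₙ p) (↧ₙ q) prime[2]
      (∣-trans 2∣r (subst (↧ₙ r ∣_) eq′ (m∣m*n ∣ n ∣))))
    where
    eq′ : ↧ₙ r ℕ.* ∣ n ∣ ≡ ↧ₙ p ℕ.* ↧ₙ q
    eq′ = trans (sym (ℤ.abs-* (↧ r) n)) (trans (cong ∣_∣ eq) (ℤ.abs-* (↧ p) (↧ q)))

  integral-+ : ∀ {p q} → Integral p → Integral q → Integral (p + q)
  integral-+ {p} {q} = integral-∣ p q (p + q) {ℤ.gcd (↥+ᵘ p q) (↧+ᵘ p q)} (↧-+ p q)
    where ↥+ᵘ = λ p q → ↥ p ℤ.* ↧ q ℤ.+ ↥ q ℤ.* ↧ p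
          ↧+ᵘ = λ p q → ↧ p ℤ.* ↧ q

  integral-* : ∀ {p q} → Integral p → Integral q → Integral (p * q)
  integral-* {p} {q} = integral-∣ p q (p * q) {ℤ.gcd (↥ p ℤ.* ↥ q) (↧ p ℤ.* ↧ q)} (↧-* p q)

  integral-neg : ∀ {p} → Integral p → Integral (- p)
  integral-neg {p} (integral ip) = integral (subst (λ d → ¬ 2 ∣ ∣ d ∣) (sym (↧-neg p)) ip)

  integral-/ : ∀ i n → ¬ 2 ∣ suc n → Integral (i / suc n)
  integral-/ i n 2∤n = integral λ 2∣d → 2∤n (∣-trans 2∣d (subst (↧ₙ (i / suc n) ∣_)
    (trans (sym (ℤ.abs-* (↧ (i / suc n)) (ℤ.gcd i (+ suc n)))) (cong ∣_∣ (↧-/ i (suc n)))) (m∣m*n _)))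

  integral-/1 : ∀ i → Integral (i / 1)
  integral-/1 i = integral-/ i 0 2∤1

  2ℚ : ℚ
  2ℚ = + 2 / 1

  -- The equation forces `v` to be ½, whose denominator is 2. The 2-adic contradictions below all
  -- reduce to this one.
  1≢2*integral : ∀ {v} → Integral v → 1ℚ ≢ 2ℚ * v
  1≢2*integral {v} (integral iv) 1≡2v = iv (subst (λ r → 2 ∣ ↧ₙ r) ½≡v (divides 1 refl))
    where
    ½≡v : ½ ≡ v
    ½≡v = trans (trans (cong (½ *_) 1≡2v) (sym (*-assoc ½ 2ℚ v))) (*-identityˡ v)

  -- This is (i/d) · (2 · j/m) = 1 after cross-multiplication, with the factors 1 that the
  -- unnormalised fractions leave behind.
  cross-multiplied : ∀ i j m d e → i ℤ.* j ≡ m ℤ.* e → d ≡ e ℤ.* + 2 →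
    i ℤ.* (+ 2 ℤ.* j) ℤ.* + 1 ≡ + 1 ℤ.* (d ℤ.* (+ 1 ℤ.* m))
  cross-multiplied i j m d e ij≡me refl =
    trans (solveℤ 2 (λ i j → i *′ (con′ (+ 2) *′ j) *′ con′ (+ 1) =′ con′ (+ 2) *′ (i *′ j)) refl i j)
   (trans (cong (+ 2 ℤ.*_) ij≡me)
          (solveℤ 2 (λ m e → con′ (+ 2) *′ (m *′ e) =′ con′ (+ 1) *′ (e *′ con′ (+ 2) *′ (con′ (+ 1) *′ m))) refl m e))
    where open ℤ.+-*-Solver using () renaming (solve to solveℤ; _:*_ to _*′_; _:=_ to _=′_; con to con′)

  -- Here j/(m + 1) is the fraction e/i, rewritten with a positive denominator, and d + 1 = 2e.
  -- Unnormalised rationals turn the claim into an identity of integers.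
  half-inverse : ∀ i d .{c : Coprime ∣ i ∣ (suc d)} m j e → i ℤ.* j ≡ + suc m ℤ.* + e → suc d ≡ e ℕ.* 2 →
    mkℚ i d c * (2ℚ * (j / suc m)) ≡ 1ℚ
  half-inverse i d {c = c} m j e ij≡me d≡2e = toℚᵘ-injective (begin
    toℚᵘ (r * (2ℚ * (j / suc m)))                ≈⟨ toℚᵘ-homo-* r (2ℚ * (j / suc m)) ⟩
    toℚᵘ r ℚᵘ.* toℚᵘ (2ℚ * (j / suc m))          ≈⟨ ℚᵘ.*-congˡ {toℚᵘ r} (toℚᵘ-homo-* 2ℚ (j / suc m)) ⟩
    toℚᵘ r ℚᵘ.* (toℚᵘ 2ℚ ℚᵘ.* toℚᵘ (j / suc m))
      ≈⟨ ℚᵘ.*-congˡ {toℚᵘ r} (ℚᵘ.*-congˡ {toℚᵘ 2ℚ} (toℚᵘ-fromℚᵘ (mkℚᵘ j m))) ⟩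
    mkℚᵘ i d ℚᵘ.* (mkℚᵘ (+ 2) 0 ℚᵘ.* mkℚᵘ j m)
      ≈⟨ *≡* (cross-multiplied i j (+ suc m) (+ suc d) (+ e) ij≡me (trans (cong +_ d≡2e) (ℤ.pos-* e 2))) ⟩
    toℚᵘ 1ℚ                                      ∎)
    where
    open ℚᵘ.≃-Reasoning
    r = mkℚ i d c

  -i*-j≡i*j : ∀ i j → (ℤ.- i) ℤ.* (ℤ.- j) ≡ i ℤ.* j
  -i*-j≡i*j = solveℤ 2 (λ i j → (-′ i) *′ (-′ j) =′ i *′ j) refl
    where open ℤ.+-*-Solver using () renaming (solve to solveℤ; _:*_ to _*′_; :-_ to -′_; _:=_ to _=′_)

  -- The valuation-ring dichotomy: if the denominator is 2e, the numerator i is odd by coprimality,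
  -- so 1/r = 2 (e/i) with e/i in ℤ₍₂₎.
  integral-or-inverse-even : ∀ r → Integral r ⊎ ∃ λ u → Integral u × r * (2ℚ * u) ≡ 1ℚ
  integral-or-inverse-even r with 2 ∣? ↧ₙ r
  ... | no 2∤d = inj₁ (integral 2∤d)
  integral-or-inverse-even (mkℚ i d c) | yes 2∣d@(divides e eq) with i
  -- Zero counts as an even numerator, which coprimality to an even denominator excludes.
  ... | + zero = contradiction-irr (c (2∣d′ , 2∣d)) λ ()
    where 2∣d′ = divides 0 refl
  ... | +[1+ m ] = inj₂ (+ e / suc m
                        , integral-/ (+ e) m (λ 2∣m → contradiction-irr (c (2∣m , 2∣d)) λ ())
                        , half-inverse +[1+ m ] d m (+ e) e refl eq)
  ... | -[1+ m ] = inj₂ ((ℤ.- + e) / suc m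
                        , integral-/ (ℤ.- + e) m (λ 2∣m → contradiction-irr (c (2∣m , 2∣d)) λ ())
                        , half-inverse -[1+ m ] d m (ℤ.- + e) e (-i*-j≡i*j (+ suc m) (+ e)) eq)

  -- Linear combinations of equations, and division.

  -- Equations are proved as linear combinations of hypotheses: the last argument is a polynomial
  -- identity without hypotheses, which the ring solver decides.
  combine₁ : ∀ {a b l r} c → l ≡ r → a - b ≡ c * (l - r) → a ≡ b
  combine₁ c e eq = p-q≡0⇒p≡q _ _ (trans eq (trans (cong (c *_) (p≡q⇒p-q≡0 e)) (*-zeroʳ c)))

  combine₂ : ∀ {a b l₁ r₁ l₂ r₂} c₁ c₂ → l₁ ≡ r₁ → l₂ ≡ r₂ →
    a - b ≡ c₁ * (l₁ - r₁) + c₂ * (l₂ - r₂) → a ≡ b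
  combine₂ c₁ c₂ e₁ e₂ eq = p-q≡0⇒p≡q _ _ (trans eq
    (cong₂ _+_ (trans (cong (c₁ *_) (p≡q⇒p-q≡0 e₁)) (*-zeroʳ c₁)) (trans (cong (c₂ *_) (p≡q⇒p-q≡0 e₂)) (*-zeroʳ c₂))))

  combine₃ : ∀ {a b l₁ r₁ l₂ r₂ l₃ r₃} c₁ c₂ c₃ → l₁ ≡ r₁ → l₂ ≡ r₂ → l₃ ≡ r₃ →
    a - b ≡ c₁ * (l₁ - r₁) + c₂ * (l₂ - r₂) + c₃ * (l₃ - r₃) → a ≡ b
  combine₃ c₁ c₂ c₃ e₁ e₂ e₃ eq = p-q≡0⇒p≡q _ _ (trans eq
    (cong₂ _+_ (cong₂ _+_ (trans (cong (c₁ *_) (p≡q⇒p-q≡0 e₁)) (*-zeroʳ c₁)) (trans (cong (c₂ *_) (p≡q⇒p-q≡0 e₂)) (*-zeroʳ c₂)))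
               (trans (cong (c₃ *_) (p≡q⇒p-q≡0 e₃)) (*-zeroʳ c₃))))

  inverse : ∀ {q} → q ≢ 0ℚ → ∃ λ u → q * u ≡ 1ℚ
  inverse {q} q≢0 = 1/ q , *-inverseʳ q
    where instance _ = ≢-nonZero q≢0

  *-cancelʳ-nonZero : ∀ {p r q} → q ≢ 0ℚ → p * q ≡ r * q → p ≡ r
  *-cancelʳ-nonZero {p} {r} {q} q≢0 pq≡rq with inverse q≢0
  ... | u , qu≡1 = combine₂ u (r - p) pq≡rq qu≡1
    (solve 4 (λ p r q u → p :- r := u :* (p :* q :- r :* q) :+ (r :- p) :* (q :* u :- con 1ℚ)) refl p r q u)

  ÷-≡ : ∀ n l q .{{_ : NonZero q}} → l * q ≡ n → n ÷ q ≡ l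
  ÷-≡ n l q lq≡n = combine₂ (- (1/ q)) l lq≡n (*-inverseʳ q)
    (solve 4 (λ n l q u → n :* u :- l := (:- u) :* (l :* q :- n) :+ l :* (q :* u :- con 1ℚ)) refl n l q (1/ q))

  -- The group law in terms of slopes.

  neg : Point → Point
  neg O         = O
  neg (aff x y) = aff x (- y)

  -- Only meaningful for two affine points; O is a junk value.
  third : ℚ → Point → Point → Point
  third l O Q = O
  third l P O = O
  third l (aff x₁ y₁) (aff x₂ y₂) = let x₃ = l * l - x₁ - x₂ in aff x₃ (l * (x₁ - x₃) - y₁)

  -- l is the slope of the line through two points of y² = x³ + a x that are not opposite: the first
  -- equation determines the slope of a chord, the second one that of a tangent, and both hold in
  -- either case.
  record Slope (a x₁ y₁ x₂ y₂ l : ℚ) : Set where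
    constructor slope
    field
      chord        : l * (x₂ - x₁) ≡ y₂ - y₁
      tangent      : l * (y₁ + y₂) ≡ x₁ * x₁ + x₁ * x₂ + x₂ * x₂ + a
      not-opposite : x₂ - x₁ ≢ 0ℚ ⊎ y₁ + y₂ ≢ 0ℚ

  addPt-opposite : ∀ a x₁ y₁ x₂ y₂ → x₂ - x₁ ≡ 0ℚ → y₁ + y₂ ≡ 0ℚ → addPt a (aff x₁ y₁) (aff x₂ y₂) ≡ O
  addPt-opposite a x₁ y₁ x₂ y₂ dx≡0 sy≡0 with x₂ - x₁ ≟ 0ℚ
  ... | no dx≢0 = contradiction dx≡0 dx≢0
  ... | yes _ with y₁ + y₂ ≟ 0ℚ
  ...   | yes _ = refl
  ...   | no sy≢0 = contradiction sy≡0 sy≢0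

  addPt-third : ∀ a x₁ y₁ x₂ y₂ l → Slope a x₁ y₁ x₂ y₂ l →
    addPt a (aff x₁ y₁) (aff x₂ y₂) ≡ third l (aff x₁ y₁) (aff x₂ y₂)
  addPt-third a x₁ y₁ x₂ y₂ l (slope chord tangent not-opposite) with x₂ - x₁ ≟ 0ℚ
  ... | no dx≢0 = cong (λ l → third l (aff x₁ y₁) (aff x₂ y₂))
                    (÷-≡ (y₂ - y₁) l (x₂ - x₁) {{≢-nonZero dx≢0}} chord)
  ... | yes dx≡0 with y₁ + y₂ ≟ 0ℚ
  ...   | yes sy≡0 = contradiction not-opposite [ (λ f → f dx≡0) , (λ f → f sy≡0) ]′
  -- With x₂ = x₁ the symmetric numerator x₁² + x₁x₂ + x₂² + a becomes the 3x₁² + a of the tangent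
  -- formula.
  ...   | no sy≢0 = cong (λ l → third l (aff x₁ y₁) (aff x₂ y₂))
                    (÷-≡ _ l (y₁ + y₂) {{≢-nonZero sy≢0}} (trans tangent
                      (combine₁ (x₂ + x₁ + x₁) (p-q≡0⇒p≡q x₂ x₁ dx≡0)
                        (solve 3 (λ x₁ x₂ a →
                           x₁ :* x₁ :+ x₁ :* x₂ :+ x₂ :* x₂ :+ a :- (con (+ 3 / 1) :* x₁ :* x₁ :+ a)
                           := (x₂ :+ x₁ :+ x₁) :* (x₂ :- x₁)) refl x₁ x₂ a))))

  -- Subtracting the curve equations gives (y₂ - y₁)(y₁ + y₂) = (x₂ - x₁)(x₁² + x₁x₂ + x₂² + a). So
  -- a slope defined by one of the two equations satisfies the other, after cancelling the nonzero
  -- factor.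
  opposite-or-slope : ∀ a x₁ y₁ x₂ y₂ → OnCurve a 0ℚ (aff x₁ y₁) → OnCurve a 0ℚ (aff x₂ y₂) →
    (x₂ - x₁ ≡ 0ℚ × y₁ + y₂ ≡ 0ℚ) ⊎ ∃ (Slope a x₁ y₁ x₂ y₂)
  opposite-or-slope a x₁ y₁ x₂ y₂ on₁ on₂ with x₂ - x₁ ≟ 0ℚ | y₁ + y₂ ≟ 0ℚ
  ... | yes dx≡0 | yes sy≡0 = inj₁ (dx≡0 , sy≡0)
  ... | no dx≢0 | _ with inverse dx≢0
  ...   | u , dxu≡1 = inj₂ (l , slope chord tangent (inj₁ dx≢0))
    where
    l = (y₂ - y₁) * u
    chord : l * (x₂ - x₁) ≡ y₂ - y₁
    chord = combine₁ (y₂ - y₁) dxu≡1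
      (solve 3 (λ s d u → s :* u :* d :- s := s :* (d :* u :- con 1ℚ)) refl (y₂ - y₁) (x₂ - x₁) u)
    tangent : l * (y₁ + y₂) ≡ x₁ * x₁ + x₁ * x₂ + x₂ * x₂ + a
    tangent = *-cancelʳ-nonZero dx≢0 (combine₃ (y₁ + y₂) (- 1ℚ) 1ℚ chord on₁ on₂
      (solve 6 (λ x₁ y₁ x₂ y₂ a l →
        l :* (y₁ :+ y₂) :* (x₂ :- x₁) :- (x₁ :* x₁ :+ x₁ :* x₂ :+ x₂ :* x₂ :+ a) :* (x₂ :- x₁)
        := (y₁ :+ y₂) :* (l :* (x₂ :- x₁) :- (y₂ :- y₁))
           :+ con (- 1ℚ) :* (y₁ :* y₁ :- (x₁ :* x₁ :* x₁ :+ a :* x₁ :+ con 0ℚ))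
           :+ con 1ℚ :* (y₂ :* y₂ :- (x₂ :* x₂ :* x₂ :+ a :* x₂ :+ con 0ℚ))) refl x₁ y₁ x₂ y₂ a l))
  opposite-or-slope a x₁ y₁ x₂ y₂ on₁ on₂ | yes dx≡0 | no sy≢0 with inverse sy≢0
  ... | u , syu≡1 = inj₂ (l , slope chord tangent (inj₂ sy≢0))
    where
    m = x₁ * x₁ + x₁ * x₂ + x₂ * x₂ + a
    l = m * u
    tangent : l * (y₁ + y₂) ≡ m
    tangent = combine₁ m syu≡1
      (solve 3 (λ s d u → s :* u :* d :- s := s :* (d :* u :- con 1ℚ)) refl m (y₁ + y₂) u)
    chord : l * (x₂ - x₁) ≡ y₂ - y₁
    chord = *-cancelʳ-nonZero sy≢0 (combine₃ (x₂ - x₁) 1ℚ (- 1ℚ) tangent on₁ on₂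
      (solve 6 (λ x₁ y₁ x₂ y₂ a l →
        l :* (x₂ :- x₁) :* (y₁ :+ y₂) :- (y₂ :- y₁) :* (y₁ :+ y₂)
        := (x₂ :- x₁) :* (l :* (y₁ :+ y₂) :- (x₁ :* x₁ :+ x₁ :* x₂ :+ x₂ :* x₂ :+ a))
           :+ con 1ℚ :* (y₁ :* y₁ :- (x₁ :* x₁ :* x₁ :+ a :* x₁ :+ con 0ℚ))
           :+ con (- 1ℚ) :* (y₂ :* y₂ :- (x₂ :* x₂ :* x₂ :+ a :* x₂ :+ con 0ℚ))) refl x₁ y₁ x₂ y₂ a l))

  onCurve-third : ∀ a x₁ y₁ x₂ y₂ l → OnCurve a 0ℚ (aff x₁ y₁) → Slope a x₁ y₁ x₂ y₂ l →
    OnCurve a 0ℚ (third l (aff x₁ y₁) (aff x₂ y₂))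
  onCurve-third a x₁ y₁ x₂ y₂ l on₁ s =
    combine₃ 1ℚ (x₃ - x₁) ((x₃ - x₁) * l) on₁ tangent chord
    (solve 6 (λ a x₁ y₁ x₂ y₂ l →
    let x₃ = l :* l :- x₁ :- x₂
        y₃ = l :* (x₁ :- x₃) :- y₁
    in y₃ :* y₃ :- (x₃ :* x₃ :* x₃ :+ a :* x₃ :+ con 0ℚ)
      := con 1ℚ :* (y₁ :* y₁ :- (x₁ :* x₁ :* x₁ :+ a :* x₁ :+ con 0ℚ))
        :+ (x₃ :- x₁) :* (l :* (y₁ :+ y₂) :- (x₁ :* x₁ :+ x₁ :* x₂ :+ x₂ :* x₂ :+ a))
        :+ (x₃ :- x₁) :* l :* (l :* (x₂ :- x₁) :- (y₂ :- y₁))) refl a x₁ y₁ x₂ y₂ l)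
    where
    open Slope s
    x₃ = l * l - x₁ - x₂

  onCurve-addPt : ∀ a P Q → OnCurve a 0ℚ P → OnCurve a 0ℚ Q → OnCurve a 0ℚ (addPt a P Q)
  onCurve-addPt a O Q on₁ on₂ = on₂
  onCurve-addPt a (aff _ _) O on₁ on₂ = on₁
  onCurve-addPt a (aff x₁ y₁) (aff x₂ y₂) on₁ on₂ with opposite-or-slope a x₁ y₁ x₂ y₂ on₁ on₂
  ... | inj₁ (dx≡0 , sy≡0) = subst (OnCurve a 0ℚ) (sym (addPt-opposite a x₁ y₁ x₂ y₂ dx≡0 sy≡0)) tt
  ... | inj₂ (l , s) = subst (OnCurve a 0ℚ) (sym (addPt-third a x₁ y₁ x₂ y₂ l s)) (onCurve-third a x₁ y₁ x₂ y₂ l on₁ s)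

  -- Reflection in the x-axis preserves the curve and turns a line of slope l into one of slope -l.
  addPt-neg : ∀ a P Q → OnCurve a 0ℚ P → OnCurve a 0ℚ Q → addPt a (neg P) (neg Q) ≡ neg (addPt a P Q)
  addPt-neg a O Q on₁ on₂ = refl
  addPt-neg a (aff _ _) O on₁ on₂ = refl
  addPt-neg a (aff x₁ y₁) (aff x₂ y₂) on₁ on₂ with opposite-or-slope a x₁ y₁ x₂ y₂ on₁ on₂
  ... | inj₁ (dx≡0 , sy≡0) = trans (addPt-opposite a x₁ (- y₁) x₂ (- y₂) dx≡0
                                     (trans (sym (neg-distrib-+ y₁ y₂)) (cong -_ sy≡0)))
                                   (cong neg (sym (addPt-opposite a x₁ y₁ x₂ y₂ dx≡0 sy≡0)))
  ... | inj₂ (l , s@(slope chord tangent not-opposite)) =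
    trans (addPt-third a x₁ (- y₁) x₂ (- y₂) (- l) (slope chord′ tangent′ not-opposite′))
   (trans (cong₂ aff
            (solve 3 (λ l x₁ x₂ → (:- l) :* (:- l) :- x₁ :- x₂ := l :* l :- x₁ :- x₂) refl l x₁ x₂)
            (solve 4 (λ l x₁ x₂ y₁ → (:- l) :* (x₁ :- ((:- l) :* (:- l) :- x₁ :- x₂)) :- (:- y₁)
               := :- (l :* (x₁ :- (l :* l :- x₁ :- x₂)) :- y₁)) refl l x₁ x₂ y₁))
          (cong neg (sym (addPt-third a x₁ y₁ x₂ y₂ l s))))
    where
    chord′ : - l * (x₂ - x₁) ≡ - y₂ - - y₁
    chord′ = combine₁ (- 1ℚ) chord (solve 5 (λ l x₁ x₂ y₁ y₂ →
      :- l :* (x₂ :- x₁) :- (:- y₂ :- :- y₁) := con (- 1ℚ) :* (l :* (x₂ :- x₁) :- (y₂ :- y₁))) refl l x₁ x₂ y₁ y₂)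
    tangent′ : - l * (- y₁ + - y₂) ≡ x₁ * x₁ + x₁ * x₂ + x₂ * x₂ + a
    tangent′ = trans (solve 3 (λ l y₁ y₂ → :- l :* (:- y₁ :+ :- y₂) := l :* (y₁ :+ y₂)) refl l y₁ y₂) tangent
    not-opposite′ : x₂ - x₁ ≢ 0ℚ ⊎ - y₁ + - y₂ ≢ 0ℚ
    not-opposite′ = [ inj₁ , (λ sy≢0 → inj₂ λ e → sy≢0 (neg-injective (trans (neg-distrib-+ y₁ y₂) e))) ]′ not-opposite

  -- The line through P, Q and -(P + Q), reflected in the x-axis, passes through -P, P + Q and -Q.
  -- Hence -P and P + Q have slope -l and their sum is Q.
  addPt-cancelˡ : ∀ a {x y} Q → OnCurve a 0ℚ (aff x y) → y ≢ 0ℚ → OnCurve a 0ℚ Q →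
    addPt a (neg (aff x y)) (addPt a (aff x y) Q) ≡ Q
  addPt-cancelˡ a {x} {y} O on₁ y≢0 on₂ = addPt-opposite a x (- y) x y (+-inverseʳ x) (+-inverseˡ y)
  addPt-cancelˡ a {x₁} {y₁} (aff x₂ y₂) on₁ y≢0 on₂ with opposite-or-slope a x₁ y₁ x₂ y₂ on₁ on₂
  ... | inj₁ (dx≡0 , sy≡0) rewrite addPt-opposite a x₁ y₁ x₂ y₂ dx≡0 sy≡0 =
    cong₂ aff (sym (p-q≡0⇒p≡q x₂ x₁ dx≡0)) (p-q≡0⇒p≡q (- y₁) y₂ (trans (sym (neg-distrib-+ y₁ y₂)) (cong -_ sy≡0)))
  ... | inj₂ (l , s@(slope chord tangent _)) =
    trans (cong (addPt a (aff x₁ (- y₁))) (addPt-third a x₁ y₁ x₂ y₂ l s))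
   (trans (addPt-third a x₁ (- y₁) x₃ y₃ (- l) (slope chord′ tangent′ not-opposite′))
          (cong₂ aff
            (solve 3 (λ l x₁ x₂ → (:- l) :* (:- l) :- x₁ :- (l :* l :- x₁ :- x₂) := x₂) refl l x₁ x₂)
            (combine₁ 1ℚ chord (solve 5 (λ l x₁ x₂ y₁ y₂ →
               (:- l) :* (x₁ :- ((:- l) :* (:- l) :- x₁ :- (l :* l :- x₁ :- x₂))) :- (:- y₁) :- y₂
               := con 1ℚ :* (l :* (x₂ :- x₁) :- (y₂ :- y₁))) refl l x₁ x₂ y₁ y₂))))
    where
    x₃ = l * l - x₁ - x₂
    y₃ = l * (x₁ - x₃) - y₁
    chord′ : - l * (x₃ - x₁) ≡ y₃ - - y₁
    chord′ = solve 4 (λ l x₁ x₃ y₁ → :- l :* (x₃ :- x₁) := (l :* (x₁ :- x₃) :- y₁) :- :- y₁) refl l x₁ x₃ y₁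
    tangent′ : - l * (- y₁ + y₃) ≡ x₁ * x₁ + x₁ * x₃ + x₃ * x₃ + a
    tangent′ = combine₂ 1ℚ l tangent chord (solve 6 (λ l x₁ x₂ y₁ y₂ a →
      let x₃ = l :* l :- x₁ :- x₂
          y₃ = l :* (x₁ :- x₃) :- y₁
      in :- l :* (:- y₁ :+ y₃) :- (x₁ :* x₁ :+ x₁ :* x₃ :+ x₃ :* x₃ :+ a)
         := con 1ℚ :* (l :* (y₁ :+ y₂) :- (x₁ :* x₁ :+ x₁ :* x₂ :+ x₂ :* x₂ :+ a))
            :+ l :* (l :* (x₂ :- x₁) :- (y₂ :- y₁))) refl l x₁ x₂ y₁ y₂ a)
    not-opposite′ : x₃ - x₁ ≢ 0ℚ ⊎ - y₁ + y₃ ≢ 0ℚ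
    not-opposite′ with x₃ - x₁ ≟ 0ℚ
    ... | no dx≢0 = inj₁ dx≢0
    -- If x₃ = x₁ then y₃ = -y₁, so the sum of the ordinates is -2y₁, which is nonzero.
    ... | yes dx≡0 = inj₂ λ e → y≢0 (combine₂ (- (+ 1 / 2)) ((+ 1 / 2) * - l) e dx≡0
      (solve 4 (λ l x₁ x₃ y₁ → y₁ :- con 0ℚ
         := con (- (+ 1 / 2)) :* (:- y₁ :+ (l :* (x₁ :- x₃) :- y₁) :- con 0ℚ)
            :+ (con (+ 1 / 2) :* :- l) :* (x₃ :- x₁ :- con 0ℚ)) refl l x₁ x₃ y₁))

  -- Odd units, and the two 2-adic classes of points.

  4ℚ 8ℚ 16ℚ : ℚ
  4ℚ = + 4 / 1
  8ℚ = + 8 / 1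
  16ℚ = + 16 / 1

  -- The units of ℤ₍₂₎, as 1 + 2 ℤ₍₂₎.
  OddUnit : ℚ → Set
  OddUnit r = ∃ λ i → Integral i × r ≡ 1ℚ + 2ℚ * i

  odd-integral : ∀ {r} → OddUnit r → Integral r
  odd-integral (i , int-i , refl) = integral-+ (integral-/1 (+ 1)) (integral-* (integral-/1 (+ 2)) int-i)

  odd-* : ∀ {r s} → OddUnit r → OddUnit s → OddUnit (r * s)
  odd-* (i , int-i , refl) (j , int-j , refl) =
    i + j + 2ℚ * (i * j) ,
    integral-+ (integral-+ int-i int-j)
      (integral-* (integral-/1 (+ 2)) (integral-* int-i int-j)) ,
    solve 2 (λ i j → (con 1ℚ :+ con 2ℚ :* i) :* (con 1ℚ :+ con 2ℚ :* j)
      := con 1ℚ :+ con 2ℚ :* (i :+ j :+ con 2ℚ :* (i :* j))) refl i j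

  odd-+even : ∀ {r j} → OddUnit r → Integral j → OddUnit (r + 2ℚ * j)
  odd-+even {j = j} (i , int-i , refl) int-j = i + j , integral-+ int-i int-j ,
    solve 2 (λ i j → con 1ℚ :+ con 2ℚ :* i :+ con 2ℚ :* j := con 1ℚ :+ con 2ℚ :* (i :+ j)) refl i j

  odd-1+even : ∀ {j} → Integral j → OddUnit (1ℚ + 2ℚ * j)
  odd-1+even {j} int-j = j , int-j , refl

  odd≢even : ∀ {r j} → OddUnit r → Integral j → r ≢ 2ℚ * j
  odd≢even {j = j} (i , int-i , refl) int-j eq =
    1≢2*integral (integral-+ int-j (integral-neg int-i))
      (combine₁ 1ℚ eq (solve 2 (λ i j → con 1ℚ :- con 2ℚ :* (j :- i)
        := con 1ℚ :* (con 1ℚ :+ con 2ℚ :* i :- con 2ℚ :* j)) refl i j))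

  odd≢0 : ∀ {r} → OddUnit r → r ≢ 0ℚ
  odd≢0 odd r≡0 = odd≢even odd (integral-/1 (+ 0)) r≡0

  -- If 1/r = 2u, then 1 = 2 · (2u² · r²) would be even.
  integral-sqrt : ∀ {r} → Integral (r * r) → Integral r
  integral-sqrt {r} int-r² with integral-or-inverse-even r
  ... | inj₁ int-r = int-r
  ... | inj₂ (u , int-u , r2u≡1) = contradiction
    (combine₁ (- (r * (2ℚ * u) + 1ℚ)) r2u≡1 (solve 2 (λ r u →
      con 1ℚ :- con 2ℚ :* (con 2ℚ :* (u :* u) :* (r :* r))
      := :- (r :* (con 2ℚ :* u) :+ con 1ℚ) :* (r :* (con 2ℚ :* u) :- con 1ℚ)) refl r u))
    (1≢2*integral (integral-*
      (integral-* (integral-/1 (+ 2)) (integral-* int-u int-u)) int-r²))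

  -- The dichotomy is applied to j = (r - 1)/2, where r² = 1 + 2i reads 4j² + 4j = 2i. If 1/j = 2u,
  -- multiplying by u² gives 1 + 2u = 2iu², so 1 would be even.
  odd-sqrt : ∀ {r} → OddUnit (r * r) → OddUnit r
  odd-sqrt {r} (i , int-i , r²≡) with integral-or-inverse-even (½ * (r - 1ℚ))
  ... | inj₁ int-j = ½ * (r - 1ℚ) , int-j ,
    solve 1 (λ r → r := con 1ℚ :+ con 2ℚ :* (con ½ :* (r :- con 1ℚ))) refl r
  ... | inj₂ (u , int-u , inv) = contradiction
    (combine₂ (u * u) (- (½ * (r - 1ℚ) * (2ℚ * u) + 1ℚ + 2ℚ * u)) r²≡ inv (solve 3 (λ r i u →
      let v = con ½ :* (r :- con 1ℚ) :* (con 2ℚ :* u)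
      in con 1ℚ :- con 2ℚ :* (i :* (u :* u) :- u)
         := (u :* u) :* (r :* r :- (con 1ℚ :+ con 2ℚ :* i)) :+ :- (v :+ con 1ℚ :+ con 2ℚ :* u) :* (v :- con 1ℚ)) refl r i u))
    (1≢2*integral (integral-+ (integral-* int-i (integral-* int-u int-u)) (integral-neg int-u)))

  -- If s is integral, s = 1 - 2is is odd; if instead 1/s = 2u, then r = 2u would be even.
  odd-inverse : ∀ {r s} → OddUnit r → r * s ≡ 1ℚ → OddUnit s
  odd-inverse {r} {s} odd-r@(i , int-i , refl) rs≡1 =
    [ integral-case , (λ w → ⊥-elim (even-case w)) ]′ (integral-or-inverse-even s)
    where
    integral-case : Integral s → OddUnit s
    integral-case int-s = - (i * s) , integral-neg (integral-* int-i int-s) ,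
      combine₁ 1ℚ rs≡1 (solve 2 (λ i s → s :- (con 1ℚ :+ con 2ℚ :* (:- (i :* s)))
        := con 1ℚ :* ((con 1ℚ :+ con 2ℚ :* i) :* s :- con 1ℚ)) refl i s)
    even-case : (∃ λ u → Integral u × s * (2ℚ * u) ≡ 1ℚ) → ⊥
    even-case (u , int-u , s2u≡1) = odd≢even odd-r int-u
      (combine₂ (2ℚ * u) (- r) rs≡1 s2u≡1 (solve 3 (λ r s u → r :- con 2ℚ :* u
        := (con 2ℚ :* u) :* (r :* s :- con 1ℚ) :+ (:- r) :* (s :* (con 2ℚ :* u) :- con 1ℚ)) refl r s u))

  -- For affine points the 2-adic valuation of x is -2 in the odd class and at most -3 in the even
  -- one. The inverse of x is given as a witness 8ε, so no division is involved; O is even because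
  -- 1/x vanishes there.
  OddPoint EvenPoint : Point → Set
  OddPoint O           = ⊥
  OddPoint (aff x y)   = OddUnit (4ℚ * x)
  EvenPoint O          = ⊤
  EvenPoint (aff x y)  = ∃ λ ε → Integral ε × x * (8ℚ * ε) ≡ 1ℚ

  -- Addition formulas cleared of 2-adic denominators.

  -- With abscissas ξ/4 and ordinates η/8, H and K are half the sums of the η's and of the ξ's; both
  -- are integral, and the sum of the points has abscissa (U² - 8 H² K)/(16 H²) with U odd.
  scaled-tangent : ∀ a l x₁ y₁ x₂ y₂ H K → H ≡ ½ * (8ℚ * y₁ + 8ℚ * y₂) → K ≡ ½ * (4ℚ * x₁ + 4ℚ * x₂) →
    l * (y₁ + y₂) ≡ x₁ * x₁ + x₁ * x₂ + x₂ * x₂ + a →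
    4ℚ * l * H ≡ 4ℚ * x₂ * (4ℚ * x₂) + 2ℚ * (4ℚ * x₁ * K + 8ℚ * a)
  scaled-tangent a l x₁ y₁ x₂ y₂ _ _ refl refl tangent = combine₁ 16ℚ tangent
    (solve 6 (λ a l x₁ y₁ x₂ y₂ →
      con 4ℚ :* l :* (con ½ :* (con 8ℚ :* y₁ :+ con 8ℚ :* y₂))
      :- (con 4ℚ :* x₂ :* (con 4ℚ :* x₂)
          :+ con 2ℚ :* (con 4ℚ :* x₁ :* (con ½ :* (con 4ℚ :* x₁ :+ con 4ℚ :* x₂)) :+ con 8ℚ :* a))
      := con 16ℚ :* (l :* (y₁ :+ y₂) :- (x₁ :* x₁ :+ x₁ :* x₂ :+ x₂ :* x₂ :+ a))) refl a l x₁ y₁ x₂ y₂)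

  -- With V = U² - 8H²K and W = 1/V, the inverse of the abscissa V/(16H²) is 8 · (2H²W), an
  -- expression that needs no division by H.
  tangent-inverse : ∀ l x₁ x₂ H K U W → 4ℚ * l * H ≡ U → K ≡ ½ * (4ℚ * x₁ + 4ℚ * x₂) →
    (U * U + 2ℚ * (- (4ℚ * (H * H) * K))) * W ≡ 1ℚ →
    (l * l - x₁ - x₂) * (8ℚ * (2ℚ * (H * H) * W)) ≡ 1ℚ
  tangent-inverse l x₁ x₂ H _ _ W refl refl VW≡1 = trans (solve 5 (λ l x₁ x₂ H W →
    (l :* l :- x₁ :- x₂) :* (con 8ℚ :* (con 2ℚ :* (H :* H) :* W))
    := (con 4ℚ :* l :* H :* (con 4ℚ :* l :* H)
        :+ con 2ℚ :* (:- (con 4ℚ :* (H :* H) :* (con ½ :* (con 4ℚ :* x₁ :+ con 4ℚ :* x₂))))) :* W)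
    refl l x₁ x₂ H W) VW≡1

  -- The scaled ordinate is y/(2x²). Dividing the curve equation by 4x⁴ and putting e = 1/x = 8ε
  -- turns its square into (e + ae³)/4, which is a polynomial in a and ε with integer coefficients.
  scaled-ordinate² : ∀ a x y ε → OnCurve a 0ℚ (aff x y) → x * (8ℚ * ε) ≡ 1ℚ →
    ½ * (y * (8ℚ * ε) * (8ℚ * ε)) * (½ * (y * (8ℚ * ε) * (8ℚ * ε))) ≡ 2ℚ * ε + + 128 / 1 * a * (ε * ε * ε)
  scaled-ordinate² a x y ε on xe≡1 = trans
    (combine₁ (½ * ½ * (e * e * e * e)) on (solve 4 (λ a x y e →
      (con ½ :* (y :* e :* e)) :* (con ½ :* (y :* e :* e))
      :- con ½ :* con ½ :* ((x :* e) :* (x :* e) :* (x :* e) :* e :+ a :* (x :* e) :* (e :* e :* e))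
      := (con ½ :* con ½ :* (e :* e :* e :* e)) :* (y :* y :- (x :* x :* x :+ a :* x :+ con 0ℚ))) refl a x y e))
   (trans (cong (λ u → ½ * ½ * (u * u * u * e + a * u * (e * e * e))) xe≡1)
      (solve 2 (λ a ε → let e = con 8ℚ :* ε in
        con ½ :* con ½ :* (con 1ℚ :* con 1ℚ :* con 1ℚ :* e :+ a :* con 1ℚ :* (e :* e :* e))
        := con 2ℚ :* ε :+ con (+ 128 / 1) :* a :* (ε :* ε :* ε)) refl a ε))
    where e = 8ℚ * ε

  -- The symmetric form of the addition law avoids the 2-adic cancellation between l² and x₂.
  symmetric-third : ∀ a l x₁ y₁ x₂ y₂ → OnCurve a 0ℚ (aff x₁ y₁) → OnCurve a 0ℚ (aff x₂ y₂) → Slope a x₁ y₁ x₂ y₂ l →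
    (l * l - x₁ - x₂) * ((x₂ - x₁) * (x₂ - x₁)) ≡ (x₁ * x₂ + a) * (x₁ + x₂) - 2ℚ * (y₁ * y₂)
  symmetric-third a l x₁ y₁ x₂ y₂ on₁ on₂ s =
    combine₃ (l * (x₂ - x₁) + (y₂ - y₁)) 1ℚ 1ℚ (Slope.chord s) on₁ on₂ (solve 6 (λ a l x₁ y₁ x₂ y₂ →
      (l :* l :- x₁ :- x₂) :* ((x₂ :- x₁) :* (x₂ :- x₁)) :- ((x₁ :* x₂ :+ a) :* (x₁ :+ x₂) :- con 2ℚ :* (y₁ :* y₂))
      := (l :* (x₂ :- x₁) :+ (y₂ :- y₁)) :* (l :* (x₂ :- x₁) :- (y₂ :- y₁))
         :+ con 1ℚ :* (y₁ :* y₁ :- (x₁ :* x₁ :* x₁ :+ a :* x₁ :+ con 0ℚ))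
         :+ con 1ℚ :* (y₂ :* y₂ :- (x₂ :* x₂ :* x₂ :+ a :* x₂ :+ con 0ℚ))) refl a l x₁ y₁ x₂ y₂)

  -- The symmetric formula times 4e², where e = 8ε = 1/x₂. Every x₂ is absorbed into x₂e = 1, and y₂
  -- survives only in the integral quantity y₂e²/2.
  cleared-symmetric : ∀ a x₃ x₁ y₁ x₂ y₂ ε →
    x₃ * ((x₂ - x₁) * (x₂ - x₁)) ≡ (x₁ * x₂ + a) * (x₁ + x₂) - 2ℚ * (y₁ * y₂) → x₂ * (8ℚ * ε) ≡ 1ℚ →
    4ℚ * x₃ * ((1ℚ + 2ℚ * (- (4ℚ * x₁ * ε))) * (1ℚ + 2ℚ * (- (4ℚ * x₁ * ε))))
    ≡ (4ℚ * x₁ + 2ℚ * (16ℚ * a * ε)) * (1ℚ + 2ℚ * (4ℚ * x₁ * ε))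
      + 2ℚ * (- (8ℚ * y₁ * (½ * (y₂ * (8ℚ * ε) * (8ℚ * ε)))))
  cleared-symmetric a x₃ x₁ y₁ x₂ y₂ ε symmetric x₂e≡1 = combine₁ 4ℚ F≡0
    (solve 6 (λ a x₃ x₁ y₁ y₂ ε → let e = con 8ℚ :* ε
                                      D = con 1ℚ :+ con 2ℚ :* (:- (con 4ℚ :* x₁ :* ε)) in
      con 4ℚ :* x₃ :* (D :* D) :-
        ((con 4ℚ :* x₁ :+ con 2ℚ :* (con 16ℚ :* a :* ε)) :* (con 1ℚ :+ con 2ℚ :* (con 4ℚ :* x₁ :* ε))
          :+ con 2ℚ :* (:- (con 8ℚ :* y₁ :* (con ½ :* (y₂ :* e :* e)))))
      := con 4ℚ :* (x₃ :* ((con 1ℚ :- x₁ :* e) :* (con 1ℚ :- x₁ :* e))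
           :- ((x₁ :* con 1ℚ :+ a :* e) :* (x₁ :* e :+ con 1ℚ) :- con 2ℚ :* (y₁ :* (y₂ :* e :* e))) :- con 0ℚ))
      refl a x₃ x₁ y₁ y₂ ε)
    where
    e = 8ℚ * ε
    -- u stands for x₂ e, which equals 1.
    F : ℚ → ℚ
    F u = x₃ * ((u - x₁ * e) * (u - x₁ * e)) - ((x₁ * u + a * e) * (x₁ * e + u) - 2ℚ * (y₁ * (y₂ * e * e)))
    F≡0 : F 1ℚ ≡ 0ℚ
    F≡0 = trans (cong F (sym x₂e≡1)) (combine₁ (e * e) symmetric (solve 7 (λ a x₃ x₁ y₁ x₂ y₂ e → let u = x₂ :* e in
      x₃ :* ((u :- x₁ :* e) :* (u :- x₁ :* e))
        :- ((x₁ :* u :+ a :* e) :* (x₁ :* e :+ u) :- con 2ℚ :* (y₁ :* (y₂ :* e :* e))) :- con 0ℚ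
      := (e :* e) :* (x₃ :* ((x₂ :- x₁) :* (x₂ :- x₁)) :- ((x₁ :* x₂ :+ a) :* (x₁ :+ x₂) :- con 2ℚ :* (y₁ :* y₂))))
      refl a x₃ x₁ y₁ x₂ y₂ e))

  divide-by-square : ∀ x N D W → x * (D * D) ≡ N → D * W ≡ 1ℚ → N * (W * W) ≡ x
  divide-by-square x _ D W refl DW≡1 = combine₁ (x * (D * W + 1ℚ)) DW≡1 (solve 3 (λ x D W →
    x :* (D :* D) :* (W :* W) :- x := (x :* (D :* W :+ con 1ℚ)) :* (D :* W :- con 1ℚ)) refl x D W)

  half-sum-integral : ∀ {r s} → OddUnit r → OddUnit s → Integral (½ * (r + s))
  half-sum-integral (i , int-i , refl) (j , int-j , refl) = subst Integral
    (solve 2 (λ i j → con 1ℚ :+ i :+ j := con ½ :* (con 1ℚ :+ con 2ℚ :* i :+ (con 1ℚ :+ con 2ℚ :* j))) refl i j)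
    (integral-+ (integral-+ (integral-/1 (+ 1)) int-i) int-j)

  even-third : ∀ l x₁ y₁ x₂ y₂ H K U → 4ℚ * l * H ≡ U → K ≡ ½ * (4ℚ * x₁ + 4ℚ * x₂) →
    OddUnit U → Integral H → Integral K → EvenPoint (third l (aff x₁ y₁) (aff x₂ y₂))
  even-third l x₁ y₁ x₂ y₂ H K U 4lH≡U K≡ odd-U int-H int-K =
    2ℚ * (H * H) * W , integral-* (integral-* (integral-/1 (+ 2)) int-H²) (odd-integral (odd-inverse odd-V VW≡1)) ,
    tangent-inverse l x₁ x₂ H K U W 4lH≡U K≡ VW≡1
    where
    int-H² : Integral (H * H)
    int-H² = integral-* int-H int-H
    odd-V : OddUnit (U * U + 2ℚ * (- (4ℚ * (H * H) * K)))
    odd-V = odd-+even (odd-* odd-U odd-U) (integral-neg (integral-* (integral-* (integral-/1 (+ 4)) int-H²) int-K))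
    W = proj₁ (inverse (odd≢0 odd-V))
    VW≡1 = proj₂ (inverse (odd≢0 odd-V))

  -- Equal abscissas would give 1 = 8x₁ε = 2 · (4x₁ · ε).
  odd-even-distinct : ∀ x₁ x₂ ε → OddUnit (4ℚ * x₁) → Integral ε → x₂ * (8ℚ * ε) ≡ 1ℚ → x₂ - x₁ ≢ 0ℚ
  odd-even-distinct x₁ x₂ ε odd₁ int-ε x₂e≡1 dx≡0 = 1≢2*integral (integral-* (odd-integral odd₁) int-ε)
    (combine₂ (- 1ℚ) (8ℚ * ε) x₂e≡1 dx≡0 (solve 3 (λ x₁ x₂ ε →
      con 1ℚ :- con 2ℚ :* (con 4ℚ :* x₁ :* ε)
      := con (- 1ℚ) :* (x₂ :* (con 8ℚ :* ε) :- con 1ℚ) :+ (con 8ℚ :* ε) :* (x₂ :- x₁ :- con 0ℚ)) refl x₁ x₂ ε))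

  -- Parity of sums of points.

  module _ {a : ℚ} (int-a : Integral a) where

    -- With ξ = 4x the curve equation becomes (8y)² = ξ³ + 16aξ, whose right side is odd.
    odd-ordinate : ∀ x y → OnCurve a 0ℚ (aff x y) → OddUnit (4ℚ * x) → OddUnit (8ℚ * y)
    odd-ordinate x y on odd-x = odd-sqrt (subst OddUnit
      (combine₁ (- (8ℚ * 8ℚ)) on (solve 3 (λ a x y →
        (con 4ℚ :* x) :* (con 4ℚ :* x) :* (con 4ℚ :* x) :+ con 2ℚ :* (con 8ℚ :* a :* (con 4ℚ :* x))
          :- con 8ℚ :* y :* (con 8ℚ :* y)
        := :- (con 8ℚ :* con 8ℚ) :* (y :* y :- (x :* x :* x :+ a :* x :+ con 0ℚ))) refl a x y))
      (odd-+even (odd-* (odd-* odd-x odd-x) odd-x)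
        (integral-* (integral-* (integral-/1 (+ 8)) int-a) (odd-integral odd-x))))

    odd-tangent : ∀ x₁ x₂ {K} → OddUnit (4ℚ * x₁) → OddUnit (4ℚ * x₂) → Integral K →
      OddUnit (4ℚ * x₂ * (4ℚ * x₂) + 2ℚ * (4ℚ * x₁ * K + 8ℚ * a))
    odd-tangent x₁ x₂ odd₁ odd₂ int-K = odd-+even (odd-* odd₂ odd₂)
      (integral-+ (integral-* (odd-integral odd₁) int-K) (integral-* (integral-/1 (+ 8)) int-a))

    odd+odd : ∀ x₁ y₁ x₂ y₂ → OnCurve a 0ℚ (aff x₁ y₁) → OnCurve a 0ℚ (aff x₂ y₂) →
      OddUnit (4ℚ * x₁) → OddUnit (4ℚ * x₂) → EvenPoint (addPt a (aff x₁ y₁) (aff x₂ y₂))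
    odd+odd x₁ y₁ x₂ y₂ on₁ on₂ odd₁ odd₂ with opposite-or-slope a x₁ y₁ x₂ y₂ on₁ on₂
    ... | inj₁ (dx≡0 , sy≡0) = subst EvenPoint (sym (addPt-opposite a x₁ y₁ x₂ y₂ dx≡0 sy≡0)) tt
    ... | inj₂ (l , s) = subst EvenPoint (sym (addPt-third a x₁ y₁ x₂ y₂ l s))
      (even-third l x₁ y₁ x₂ y₂ _ _ _ (scaled-tangent a l x₁ y₁ x₂ y₂ _ _ refl refl (Slope.tangent s)) refl
        (odd-tangent x₁ x₂ odd₁ odd₂ int-K)
        (half-sum-integral (odd-ordinate x₁ y₁ on₁ odd₁) (odd-ordinate x₂ y₂ on₂ odd₂)) int-K)
      where int-K = half-sum-integral odd₁ odd₂

    integral-scaled-ordinate : ∀ x y ε → OnCurve a 0ℚ (aff x y) → Integral ε → x * (8ℚ * ε) ≡ 1ℚ →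
      Integral (½ * (y * (8ℚ * ε) * (8ℚ * ε)))
    integral-scaled-ordinate x y ε on int-ε xe≡1 = integral-sqrt (subst Integral (sym (scaled-ordinate² a x y ε on xe≡1))
      (integral-+ (integral-* (integral-/1 (+ 2)) int-ε)
        (integral-* (integral-* (integral-/1 (+ 128)) int-a) (integral-* (integral-* int-ε int-ε) int-ε))))

    -- `cleared-symmetric` has the form 4x₃ · D² = N with N and D odd, so 4x₃ = N W² with W = 1/D.
    odd-third : ∀ l x₁ y₁ x₂ y₂ ε → OnCurve a 0ℚ (aff x₁ y₁) → OnCurve a 0ℚ (aff x₂ y₂) → Slope a x₁ y₁ x₂ y₂ l →
      OddUnit (4ℚ * x₁) → Integral ε → x₂ * (8ℚ * ε) ≡ 1ℚ → OddPoint (third l (aff x₁ y₁) (aff x₂ y₂))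
    odd-third l x₁ y₁ x₂ y₂ ε on₁ on₂ s odd₁ int-ε x₂e≡1 = subst OddUnit
      (divide-by-square (4ℚ * (l * l - x₁ - x₂)) _ (1ℚ + 2ℚ * (- (4ℚ * x₁ * ε))) W
        (cleared-symmetric a (l * l - x₁ - x₂) x₁ y₁ x₂ y₂ ε (symmetric-third a l x₁ y₁ x₂ y₂ on₁ on₂ s) x₂e≡1) DW≡1)
      (odd-* odd-N (odd-* odd-W odd-W))
      where
      int-xε : Integral (4ℚ * x₁ * ε)
      int-xε = integral-* (odd-integral odd₁) int-ε
      odd-D : OddUnit (1ℚ + 2ℚ * (- (4ℚ * x₁ * ε)))
      odd-D = odd-1+even (integral-neg int-xε)
      W = proj₁ (inverse (odd≢0 odd-D))
      DW≡1 = proj₂ (inverse (odd≢0 odd-D))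
      odd-W : OddUnit W
      odd-W = odd-inverse odd-D DW≡1
      odd-N : OddUnit ((4ℚ * x₁ + 2ℚ * (16ℚ * a * ε)) * (1ℚ + 2ℚ * (4ℚ * x₁ * ε))
                       + 2ℚ * (- (8ℚ * y₁ * (½ * (y₂ * (8ℚ * ε) * (8ℚ * ε))))))
      odd-N = odd-+even
        (odd-* (odd-+even odd₁ (integral-* (integral-* (integral-/1 (+ 16)) int-a) int-ε)) (odd-1+even int-xε))
        (integral-neg (integral-* (odd-integral (odd-ordinate x₁ y₁ on₁ odd₁))
          (integral-scaled-ordinate x₂ y₂ ε on₂ int-ε x₂e≡1)))

    odd+even : ∀ x₁ y₁ Q → OnCurve a 0ℚ (aff x₁ y₁) → OnCurve a 0ℚ Q →
      OddUnit (4ℚ * x₁) → EvenPoint Q → OddPoint (addPt a (aff x₁ y₁) Q)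
    odd+even x₁ y₁ O on₁ on₂ odd₁ even₂ = odd₁
    odd+even x₁ y₁ (aff x₂ y₂) on₁ on₂ odd₁ (ε , int-ε , x₂e≡1) with opposite-or-slope a x₁ y₁ x₂ y₂ on₁ on₂
    ... | inj₁ (dx≡0 , _) = ⊥-elim (odd-even-distinct x₁ x₂ ε odd₁ int-ε x₂e≡1 dx≡0)
    ... | inj₂ (l , s) = subst OddPoint (sym (addPt-third a x₁ y₁ x₂ y₂ l s))
      (odd-third l x₁ y₁ x₂ y₂ ε on₁ on₂ s odd₁ int-ε x₂e≡1)

    odd-ordinate≢0 : ∀ x y → OnCurve a 0ℚ (aff x y) → OddUnit (4ℚ * x) → y ≢ 0ℚ
    odd-ordinate≢0 x _ on odd-x refl = odd≢0 (odd-ordinate x 0ℚ on odd-x) refl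

    -- If y = 0, multiplying x³ + ax = 0 by e³ with e = 1/x = 8ε gives 1 + ae² = 0, so 1 = -64aε²
    -- would be even.
    even-ordinate≢0 : ∀ x y → OnCurve a 0ℚ (aff x y) → EvenPoint (aff x y) → y ≢ 0ℚ
    even-ordinate≢0 x y on (ε , int-ε , xe≡1) y≡0 = 1≢2*integral
      (integral-neg (integral-* (integral-* (integral-/1 (+ 32)) int-a) (integral-* int-ε int-ε))) (sym -64aε²≡1)
      where
      e = 8ℚ * ε
      f≡0 : x * x * x + a * x + 0ℚ ≡ 0ℚ
      f≡0 = trans (sym on) (trans (cong (_* y) y≡0) (*-zeroˡ y))
      F : ℚ → ℚ
      F u = u * u * u + a * (e * e) * u
      F≡0 : F 1ℚ ≡ 0ℚ
      F≡0 = trans (cong F (sym xe≡1)) (combine₁ (e * e * e) f≡0 (solve 3 (λ a x e → let u = x :* e in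
        u :* u :* u :+ a :* (e :* e) :* u :- con 0ℚ
        := (e :* e :* e) :* (x :* x :* x :+ a :* x :+ con 0ℚ :- con 0ℚ)) refl a x e))
      -64aε²≡1 : 2ℚ * (- (+ 32 / 1 * a * (ε * ε))) ≡ 1ℚ
      -64aε²≡1 = combine₁ (- 1ℚ) F≡0 (solve 2 (λ a ε → let e = con 8ℚ :* ε in
        con 2ℚ :* (:- (con (+ 32 / 1) :* a :* (ε :* ε))) :- con 1ℚ
        := con (- 1ℚ) :* (con 1ℚ :* con 1ℚ :* con 1ℚ :+ a :* (e :* e) :* con 1ℚ :- con 0ℚ)) refl a ε)

  -- Multiples of an odd point, and the descent.

  half : ∀ n → ∃ λ k → n ≡ k ℕ.* 2 ⊎ n ≡ suc (k ℕ.* 2)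
  half zero = 0 , inj₁ refl
  half (suc n) with half n
  ... | k , inj₁ refl = k , inj₂ refl
  ... | k , inj₂ refl = suc k , inj₁ refl

  module Multiples {a : ℚ} (int-a : Integral a) {x y : ℚ}
                   (on : OnCurve a 0ℚ (aff x y)) (odd-x : OddUnit (4ℚ * x)) where

    P : Point
    P = aff x y

    onCurve-mulPt : ∀ n → OnCurve a 0ℚ (mulPt a n P)
    onCurve-mulPt zero    = tt
    onCurve-mulPt (suc n) = onCurve-addPt a P (mulPt a n P) on (onCurve-mulPt n)

    addPt-odd : ∀ Q → OnCurve a 0ℚ Q → OddPoint Q → EvenPoint (addPt a P Q)
    addPt-odd (aff x₂ y₂) on₂ odd₂ = odd+odd int-a x y x₂ y₂ on on₂ odd-x odd₂

    mulPt-even : ∀ k → EvenPoint (mulPt a (k ℕ.* 2) P)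
    mulPt-odd  : ∀ k → OddPoint (mulPt a (suc (k ℕ.* 2)) P)
    mulPt-even zero    = tt
    mulPt-even (suc k) = addPt-odd _ (onCurve-mulPt (suc (k ℕ.* 2))) (mulPt-odd k)
    mulPt-odd k = odd+even int-a x y _ on (onCurve-mulPt (k ℕ.* 2)) odd-x (mulPt-even k)

    mulPt-ordinate≢0 : ∀ n {x y} → mulPt a n P ≡ aff x y → y ≢ 0ℚ
    mulPt-ordinate≢0 n {x} {y} eq with half n
    ... | k , inj₁ refl = even-ordinate≢0 int-a x y
      (subst (OnCurve a 0ℚ) eq (onCurve-mulPt n)) (subst EvenPoint eq (mulPt-even k))
    ... | k , inj₂ refl = odd-ordinate≢0 int-a x y
      (subst (OnCurve a 0ℚ) eq (onCurve-mulPt n)) (subst OddPoint eq (mulPt-odd k))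

    -- Induction on j: adding -P to the equation for j and i + 1 turns (i + 1) P into i P, by
    -- cancellation, and -(j P) into -((j + 1) P).
    mulPt-reflect : ∀ {n} → mulPt a n P ≡ O → ∀ j i → j ℕ.+ i ≡ n → mulPt a i P ≡ neg (mulPt a j P)
    mulPt-reflect nP≡O zero    i refl = nP≡O
    mulPt-reflect nP≡O (suc j) i j+i≡n = begin
      iP                                ≡⟨ addPt-cancelˡ a iP on (odd-ordinate≢0 int-a x y on odd-x) (onCurve-mulPt i) ⟨
      addPt a (neg P) (addPt a P iP)    ≡⟨ cong (addPt a (neg P)) (mulPt-reflect nP≡O j (suc i) (trans (ℕ.+-suc j i) j+i≡n)) ⟩
      addPt a (neg P) (neg jP)          ≡⟨ addPt-neg a P jP on (onCurve-mulPt j) ⟩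
      neg (addPt a P jP)                ∎
      where
      open ≡-Reasoning
      iP = mulPt a i P
      jP = mulPt a j P

    mulPt-self-neg : ∀ k → mulPt a k P ≡ neg (mulPt a k P) → mulPt a k P ≡ O
    mulPt-self-neg k self-neg with mulPt a k P in eq
    ... | O = refl
    ... | aff x′ y′ = contradiction y′≡0 (mulPt-ordinate≢0 k eq)
      where
      ordinate : Point → ℚ
      -- A junk value: both sides of `self-neg` are affine here.
      ordinate O = 0ℚ
      ordinate (aff _ y) = y
      y′≡0 : y′ ≡ 0ℚ
      y′≡0 = combine₁ ½ (cong ordinate self-neg) (solve 1 (λ y → y :- con 0ℚ := con ½ :* (y :- :- y)) refl y′)

    mulPt≢O : ∀ n → n ℕ.≥ 1 → mulPt a n P ≢ O
    mulPt≢O = <-rec _ step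
      where
      step : ∀ n → (∀ {m} → m ℕ.< n → m ℕ.≥ 1 → mulPt a m P ≢ O) → n ℕ.≥ 1 → mulPt a n P ≢ O
      step n rec n≥1 nP≡O with half n
      -- For odd n, transport along `nP≡O` yields an element of `OddPoint O`, which is empty.
      ... | k , inj₂ refl = subst OddPoint nP≡O (mulPt-odd k)
      -- Here n = 2m with m = k + 1. Reflection at the midpoint gives m P = -(m P), hence m P = O
      -- with m < n.
      step .(suc k ℕ.* 2) rec n≥1 nP≡O | suc k , inj₁ refl =
        rec (ℕ.m<m*n (suc k) 2 (s≤s (s≤s z≤n))) (s≤s z≤n)
          (mulPt-self-neg (suc k) (mulPt-reflect nP≡O (suc k) (suc k) k+k≡k*2))
        where
        k+k≡k*2 : suc k ℕ.+ suc k ≡ suc k ℕ.* 2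
        k+k≡k*2 = trans (cong (suc k ℕ.+_) (sym (ℕ.+-identityʳ (suc k)))) (ℕ.*-comm 2 (suc k))

  -- The point on the curve, and the two cases.

  rank-of-square : ∀ p s → s ℤ.* s ≡ + 4 ℤ.* p ℤ.+ + 5 → RankAtLeastOne ((ℤ.- (+ 5 ℤ.* p)) / 1) 0ℚ
  rank-of-square p s s²≡4p+5 = aff x y , on , Multiples.mulPt≢O (integral-/1 (ℤ.- (+ 5 ℤ.* p))) on odd-x
    where
    a P S x y : ℚ
    a = (ℤ.- (+ 5 ℤ.* p)) / 1
    P = p / 1
    S = s / 1
    -- Since 5p = 5(s² - 5)/4, this x satisfies x² - 5p = ((s² - 10)/4)². As x = (s/2)², the product
    -- x (x² - 5p) is a square too, with root y.
    x = + 1 / 4 * (S * S)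
    y = + 1 / 8 * (S * (S * S - + 10 / 1))
    a≡-5P : a ≡ - (+ 5 / 1 * P)
    a≡-5P = trans (/1-homo-neg (+ 5 ℤ.* p)) (cong -_ (/1-homo-* (+ 5) p))
    S²≡4P+5 : S * S ≡ 4ℚ * P + + 5 / 1
    S²≡4P+5 = trans (sym (/1-homo-* s s)) (trans (cong (_/ 1) s²≡4p+5)
      (trans (/1-homo-+ (+ 4 ℤ.* p) (+ 5)) (cong (_+ + 5 / 1) (/1-homo-* (+ 4) p))))
    -- Stated for variables, so that matching on `refl` can replace a by -5P before the ring solver
    -- runs.
    on-curve : ∀ a P S → a ≡ - (+ 5 / 1 * P) → S * S ≡ 4ℚ * P + + 5 / 1 →
      OnCurve a 0ℚ (aff (+ 1 / 4 * (S * S)) (+ 1 / 8 * (S * (S * S - + 10 / 1))))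
    on-curve _ P S refl S²≡ = combine₁ (- (+ 5 / 16) * (S * S)) S²≡ (solve 2 (λ P S →
      let x = con (+ 1 / 4) :* (S :* S)
          y = con (+ 1 / 8) :* (S :* (S :* S :- con (+ 10 / 1)))
      in y :* y :- (x :* x :* x :+ (:- (con (+ 5 / 1) :* P)) :* x :+ con 0ℚ)
         := (con (- (+ 5 / 16)) :* (S :* S)) :* (S :* S :- (con 4ℚ :* P :+ con (+ 5 / 1)))) refl P S)
    on : OnCurve a 0ℚ (aff x y)
    on = on-curve a P S a≡-5P S²≡4P+5
    four-x : ∀ P S → S * S ≡ 4ℚ * P + + 5 / 1 → 4ℚ * (+ 1 / 4 * (S * S)) ≡ 1ℚ + 2ℚ * (2ℚ * P + 2ℚ)
    four-x P S S²≡ = combine₁ 1ℚ S²≡ (solve 2 (λ P S →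
      con 4ℚ :* (con (+ 1 / 4) :* (S :* S)) :- (con 1ℚ :+ con 2ℚ :* (con 2ℚ :* P :+ con 2ℚ))
      := con 1ℚ :* (S :* S :- (con 4ℚ :* P :+ con (+ 5 / 1)))) refl P S)
    odd-x : OddUnit (4ℚ * x)
    -- The witness comes from 4x = s² = 4p + 5 = 1 + 2 (2p + 2).
    odd-x = 2ℚ * P + 2ℚ ,
      integral-+ (integral-* (integral-/1 (+ 2)) (integral-/1 p)) (integral-/1 (+ 2)) ,
      four-x P S S²≡4P+5

open RationalPoints using (rank-of-square)
open import Data.Nat using (ℕ)
open import Data.Nat.Primality using (Prime)
open import Data.Integer using (ℤ; +_; -_; _+_; _*_)
open import Data.Rational using (0ℚ; _/_)
open import Data.Product using (∃; _×_; _,_)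
open import Data.Sum using (_⊎_; inj₁; inj₂)
open import Relation.Binary.PropositionalEquality using (_≢_; _≡_; refl; trans; sym; cong)
open import Data.Integer.Solver using (module +-*-Solver)
open +-*-Solver

theorem1p3 : (p : ℕ) → Prime p → p ≢ 2 →
    ((∃ λ (k₃ : ℤ) → + p ≡ + 40 * k₃ + + 11 × IsPerfectSquare (+ 160 * k₃ + + 49))
    ⊎ (∃ λ (k₄ : ℤ) → + p ≡ + 40 * k₄ + + 19 × IsPerfectSquare (+ 160 * k₄ + + 81))) →
    RankAtLeastOne ((- (+ 5 * + p)) / 1) 0ℚ
-- Both cases say that 4p + 5 is a square: 4 (40k + 11) + 5 = 160k + 49 and 4 (40k + 19) + 5 = 160k
-- + 81.
theorem1p3 p _ _ (inj₁ (k , p≡ , s , s²≡)) = rank-of-square (+ p) s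
  (trans (sym s²≡) (trans (solve 1 (λ k → con (+ 160) :* k :+ con (+ 49)
    := con (+ 4) :* (con (+ 40) :* k :+ con (+ 11)) :+ con (+ 5)) refl k) (cong (λ q → + 4 * q + + 5) (sym p≡))))
theorem1p3 p _ _ (inj₂ (k , p≡ , s , s²≡)) = rank-of-square (+ p) s
  (trans (sym s²≡) (trans (solve 1 (λ k → con (+ 160) :* k :+ con (+ 81)
    := con (+ 4) :* (con (+ 40) :* k :+ con (+ 19)) :+ con (+ 5)) refl k) (cong (λ q → + 4 * q + + 5) (sym p≡))))
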